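{- (Mutual exclusion for Peterson's algorithm.) Consider the model of Peterson's two-thread algorithm described in the context, i.e. all runs of the algorithm that satisfy the ownership conditions $\mathsf{OwnFlag}_i$ and $\mathsf{OwnVictim}_i$ ($i\in\{0,1\}$), the deterministic postconditions of the assignments, and the frame condition for $\mathtt{victim}$. Then the formula $$\mathbf{Always}\,\neg(\mathsf{InCS}_0\wedge\mathsf{InCS}_1)$$ holds at every point $(\pi,t)$ of the model; i.e. there is no run $\pi$ of the model and no time $t$ at which both threads are at location $\ell^{\mathsf{cs}}$.
   Context: **Program.** Threads are $0$ and $1$; for a thread $i$ write $j=1-i$. Shared variables: $\mathtt{flag}[0],\mathtt{flag}[1]\in\{0,1\}$ and $\mathtt{victim}\in\{0,1\}$. Thread $i$ executes, in program order: `flag[i]=1; victim=i; while (flag[j]==1 && victim==i) {spin}; critical section; flag[i]=0`. Its control locations are $\ell^{\mathsf{flag}}$ (about to execute `flag[i]=1`), $\ell^{\mathsf{victim}}$ (about to execute `victim=i`), $\ell^{\mathsf{waitF}},\ell^{\mathsf{waitV}}$ (spin loop), $\ell^{\mathsf{cs}}$ (critical section), $\ell^{\mathsf{exit}}$ (about to execute `flag[i]=0`); a terminated thread is accommodated by stuttering (a self-loop at a final location). The loop guard is split into read micro-steps with one shared access each: from $\ell^{\mathsf{waitF}}$ a step reads $\mathtt{flag}[j]$ and enters $\ell^{\mathsf{cs}}$ if it reads $0$, otherwise it moves to $\ell^{\mathsf{waitV}}$; from $\ell^{\mathsf{waitV}}$ a step reads $\mathtt{victim}$ and enters $\ell^{\mathsf{cs}}$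 iff $\mathtt{victim}\neq i$, else it goes back to $\ell^{\mathsf{waitF}}$. Thus, by control flow: thread $i$ executes `flag[i]=1` before reaching $\ell^{\mathsf{cs}}$, and executes `flag[i]=0` only after leaving the critical section; `victim=i` is preceded by `flag[i]=1` and executed immediately before entering the spin loop; thread $i$'s other steps do not write $\mathtt{flag}[i]$; the spin loop writes neither $\mathtt{flag}[i]$ nor $\mathtt{victim}$. **Runs.** A global state consists of the shared store and, for each thread $i$, a local component $\lambda_i$ (control location and local variables, including registers recording the last value read from each shared variable that $i$ reads). A run is an infinite sequence $\pi=s_0s_1\cdots$ of global states in which each step $s_t\to s_{t+1}$ is a step of exactly one thread $\mathsf{act}(t)$; a step of one thread leaves the other thread's local component unchanged. Points are pairs $(\pi,t)$, $t\ge0$. **Formulas.** State predicates are evaluated in $s_t$; $\mathsf{at}(i,\ell)$ says that thread $i$ is at location $\ell$, and $\mathsf{InCS}_i:=\mathsf{at}(i,\ell^{\mathsf{cs}})$. $(\pi,t)\models\mathbf{Prev}\,\phi$ iff $t>0$ and $(\pi,t-1)\models\phi$. $(\pi,t)\models\mathbf{Always}\,\phi$ iff $(\pi,k)\models\phi$ for all $0\le k\le t$. $\mathsf{after}_i$ holds at $(\pi,t)$ iff $t>0$ and $\mathsf{act}(t-1)=i$. $x=\mathbf{Prev}\,x$ holds at $(\pi,t)$ iff $t=0$ or $x$ has the same value in $s_{t-1}$ and $s_t$. Events: $\mathsf{SetFlag}_i:=\mathsf{after}_i\wedge\mathbf{Prev}\,\mathsf{at}(i,\ell^{\mathsf{flag}})$,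 $\mathsf{SetVictim}_i:=\mathsf{after}_i\wedge\mathbf{Prev}\,\mathsf{at}(i,\ell^{\mathsf{victim}})$, $\mathsf{ClearFlag}_i:=\mathsf{after}_i\wedge\mathbf{Prev}\,\mathsf{at}(i,\ell^{\mathsf{exit}})$. **Model constraints.** The model consists of the runs at all points of which the following hold, for $i\in\{0,1\}$: - $\mathsf{OwnFlag}_i:=\mathbf{Always}(\neg\mathsf{after}_i\rightarrow \mathtt{flag}[i]=\mathbf{Prev}\,\mathtt{flag}[i])$; - $\mathsf{OwnVictim}_i:=\mathbf{Always}(\mathsf{after}_i\wedge\mathbf{Prev}\,\mathsf{at}(i,\ell^{\mathsf{victim}})\rightarrow\mathtt{victim}=i)$; - postconditions: $\mathbf{Always}(\mathsf{SetFlag}_i\rightarrow\mathtt{flag}[i]=1)$, $\mathbf{Always}(\mathsf{ClearFlag}_i\rightarrow\mathtt{flag}[i]=0)$, $\mathbf{Always}(\mathsf{SetVictim}_i\rightarrow\mathtt{victim}=i)$; - frame condition: $\mathbf{Always}\bigl(\neg(\mathsf{SetVictim}_0\vee\mathsf{SetVictim}_1)\rightarrow\mathtt{victim}=\mathbf{Prev}\,\mathtt{victim}\bigr)$. -}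

module Defs where

open import Data.Empty using (⊥)
open import Data.Fin using (Fin; opposite)
open import Data.Fin.Patterns using (0F; 1F)
open import Data.Nat using (ℕ; zero; suc; _≤_)
open import Data.Product using (_×_; _,_)
open import Data.Sum using (_⊎_)
open import Data.Unit using (⊤)
open import Level using (0ℓ)
open import Relation.Binary.PropositionalEquality using (_≡_; _≢_)
open import Relation.Unary using (Pred; ∁; _∩_; _∪_; _⇒_)

Thread : Set
Thread = Fin 2

Value : Set
Value = Fin 2

data Location : Set where
  ℓflag ℓvictim ℓwaitF ℓwaitV ℓcs ℓexit ℓfinal : Location

-- The registers hold the values last read from flag[1 - i] and from victim.
record Local : Set where
  constructor ⟨_,_,_⟩
  field
    loc       : Location
    flagReg   : Value
    victimReg : Value
open Local public

record State : Set where
  field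
    flag   : Thread → Value
    victim : Thread
    local  : Thread → Local
open State public

-- LocalStep i s λᵢ λᵢ′ : control flow and register updates of one step of
-- thread i taken in global state s.  `opposite i` is 1 - i.
-- The code of the critical section is unspecified and may take any number of
-- steps (inCS) before it is left (leaveCS).
data LocalStep (i : Thread) (s : State) : Local → Local → Set where
  setFlag     : ∀ {f v} → LocalStep i s ⟨ ℓflag , f , v ⟩ ⟨ ℓvictim , f , v ⟩
  setVictim   : ∀ {f v} → LocalStep i s ⟨ ℓvictim , f , v ⟩ ⟨ ℓwaitF , f , v ⟩
  readFlag0   : ∀ {f v} → flag s (opposite i) ≡ 0F →
                LocalStep i s ⟨ ℓwaitF , f , v ⟩ ⟨ ℓcs , flag s (opposite i) , v ⟩
  readFlag1   : ∀ {f v} → flag s (opposite i) ≢ 0F →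
                LocalStep i s ⟨ ℓwaitF , f , v ⟩ ⟨ ℓwaitV , flag s (opposite i) , v ⟩
  readVictim≢ : ∀ {f v} → victim s ≢ i →
                LocalStep i s ⟨ ℓwaitV , f , v ⟩ ⟨ ℓcs , f , victim s ⟩
  readVictim≡ : ∀ {f v} → victim s ≡ i →
                LocalStep i s ⟨ ℓwaitV , f , v ⟩ ⟨ ℓwaitF , f , victim s ⟩
  inCS        : ∀ {f v} → LocalStep i s ⟨ ℓcs , f , v ⟩ ⟨ ℓcs , f , v ⟩
  leaveCS     : ∀ {f v} → LocalStep i s ⟨ ℓcs , f , v ⟩ ⟨ ℓexit , f , v ⟩
  clearFlag   : ∀ {f v} → LocalStep i s ⟨ ℓexit , f , v ⟩ ⟨ ℓfinal , f , v ⟩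
  stutter     : ∀ {f v} → LocalStep i s ⟨ ℓfinal , f , v ⟩ ⟨ ℓfinal , f , v ⟩

-- A step constrains the store only by which writes the program text rules out.
-- The effects of the assignments, and the absence of interference by the other
-- thread, are the model constraints in `Model` below.
record Step (i : Thread) (s s′ : State) : Set where
  field
    localStep      : LocalStep i s (local s i) (local s′ i)
    otherLocal     : local s′ (opposite i) ≡ local s (opposite i)
    ownFlagUnwritten :
      loc (local s i) ≢ ℓflag → loc (local s i) ≢ ℓexit → flag s′ i ≡ flag s i
    spinVictimUnwritten :
      loc (local s i) ≡ ℓwaitF ⊎ loc (local s i) ≡ ℓwaitV → victim s′ ≡ victim s

-- Both threads start at the beginning of their program; the initial store and
-- the initial register contents are arbitrary.
record Run : Set where
  field
    state : ℕ → State
    act   : ℕ → Thread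
    start : ∀ i → loc (local (state 0) i) ≡ ℓflag
    step  : ∀ t → Step (act t) (state t) (state (suc t))
open Run public

Point : Set
Point = Run × ℕ

Formula : Set₁
Formula = Pred Point 0ℓ

infix 4 _⊨_
_⊨_ : Point → Formula → Set
p ⊨ φ = φ p

Prev : Formula → Formula
Prev φ (π , zero)  = ⊥
Prev φ (π , suc t) = (π , t) ⊨ φ

Always : Formula → Formula
Always φ (π , t) = ∀ k → k ≤ t → (π , k) ⊨ φ

after : Thread → Formula
after i (π , zero)  = ⊥
after i (π , suc t) = act π t ≡ i

-- The formula x = Prev x.
Unchanged : (State → Fin 2) → Formula
Unchanged x (π , zero)  = ⊤
Unchanged x (π , suc t) = x (state π (suc t)) ≡ x (state π t)

at : Thread → Location → Formula
at i ℓ (π , t) = loc (local (state π t) i) ≡ ℓ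

InCS : Thread → Formula
InCS i = at i ℓcs

flagIs : Thread → Value → Formula
flagIs i b (π , t) = flag (state π t) i ≡ b

victimIs : Thread → Formula
victimIs i (π , t) = victim (state π t) ≡ i

SetFlag SetVictim ClearFlag : Thread → Formula
SetFlag   i = after i ∩ Prev (at i ℓflag)
SetVictim i = after i ∩ Prev (at i ℓvictim)
ClearFlag i = after i ∩ Prev (at i ℓexit)

OwnFlag OwnVictim : Thread → Formula
OwnFlag   i = Always (∁ (after i) ⇒ Unchanged (λ s → flag s i))
OwnVictim i = Always ((after i ∩ Prev (at i ℓvictim)) ⇒ victimIs i)

PostSetFlag PostClearFlag PostSetVictim : Thread → Formula
PostSetFlag   i = Always (SetFlag i ⇒ flagIs i 1F)
PostClearFlag i = Always (ClearFlag i ⇒ flagIs i 0F)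
PostSetVictim i = Always (SetVictim i ⇒ victimIs i)

VictimFrame : Formula
VictimFrame = Always (∁ (SetVictim 0F ∪ SetVictim 1F) ⇒ Unchanged victim)

record Model (π : Run) : Set where
  field
    ownFlag       : ∀ i t → (π , t) ⊨ OwnFlag i
    ownVictim     : ∀ i t → (π , t) ⊨ OwnVictim i
    postSetFlag   : ∀ i t → (π , t) ⊨ PostSetFlag i
    postClearFlag : ∀ i t → (π , t) ⊨ PostClearFlag i
    postSetVictim : ∀ i t → (π , t) ⊨ PostSetVictim i
    victimFrame   : ∀ t → (π , t) ⊨ VictimFrame

{-# OPTIONS --safe #-}

-- Two facts are invariant along a run of the model: flag[i] = 1 while thread i
-- is between its two assignments to flag[i], and if i is in the critical
-- section while the other thread j is contending (spinning or in the critical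
-- section), then victim = j.  The second is established either by i entering,
-- which it can do past a contending j (so with flag[j] = 1) only by reading
-- victim ≠ i, or by j executing victim = j.  With both threads in the critical
-- section, victim would be both 0 and 1.
module Submission where

open import Defs
open import Data.Fin.Patterns using (0F; 1F)
open import Data.Fin using (opposite)
open import Data.Fin.Properties using (_≟_)
open import Data.Nat using (ℕ; zero; suc)
open import Data.Nat.Properties using (≤-refl)
open import Data.Product using (_×_; _,_)
open import Data.Sum using (_⊎_; inj₁; inj₂)
open import Relation.Binary.PropositionalEquality
  using (_≡_; _≢_; refl; sym; trans; cong; subst)
open import Relation.Nullary using (¬_; yes; no; contradiction)
open import Relation.Unary using (∁; _∩_)

-- `cs` counts as contending so that, with both threads in the critical section, the victim
-- invariant applies in both directions.
data Contending : Location → Set where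
  waitF : Contending ℓwaitF
  waitV : Contending ℓwaitV
  cs    : Contending ℓcs

data Claiming : Location → Set where
  assigning  : Claiming ℓvictim
  contending : ∀ {ℓ} → Contending ℓ → Claiming ℓ

≢⇒≡opposite : ∀ {i j : Thread} → i ≢ j → j ≡ opposite i
≢⇒≡opposite {0F} {0F} i≢j = contradiction refl i≢j
≢⇒≡opposite {0F} {1F} _   = refl
≢⇒≡opposite {1F} {0F} _   = refl
≢⇒≡opposite {1F} {1F} i≢j = contradiction refl i≢j

≢-unique : ∀ {i j k : Thread} → i ≢ j → i ≢ k → j ≡ k
≢-unique i≢j i≢k = trans (≢⇒≡opposite i≢j) (sym (≢⇒≡opposite i≢k))

-- Control flow read backwards: the only edge into the claiming locations from outside is the
-- assignment `flag[i] = 1`.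
claiming-before : ∀ {i s l l′} → LocalStep i s l l′ → Claiming (loc l′) →
                  loc l ≡ ℓflag ⊎ Claiming (loc l)
claiming-before setFlag         _ = inj₁ refl
claiming-before setVictim       _ = inj₂ assigning
claiming-before (readFlag0 _)   _ = inj₂ (contending waitF)
claiming-before (readFlag1 _)   _ = inj₂ (contending waitF)
claiming-before (readVictim≢ _) _ = inj₂ (contending waitV)
claiming-before (readVictim≡ _) _ = inj₂ (contending waitV)
claiming-before inCS            _ = inj₂ (contending cs)
claiming-before leaveCS   (contending ())
claiming-before clearFlag (contending ())
claiming-before stutter   (contending ())

contending-before : ∀ {i s l l′} → LocalStep i s l l′ → Contending (loc l′) →
                    loc l ≡ ℓvictim ⊎ Contending (loc l)
contending-before setVictim       _ = inj₁ refl
contending-before (readFlag0 _)   _ = inj₂ waitF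
contending-before (readFlag1 _)   _ = inj₂ waitF
contending-before (readVictim≢ _) _ = inj₂ waitV
contending-before (readVictim≡ _) _ = inj₂ waitV
contending-before inCS            _ = inj₂ cs

-- Keeps the value read by the guard as evidence; `already` covers further steps inside the critical
-- section.
data EntersCS (i : Thread) (s : State) (ℓ : Location) : Set where
  already  : ℓ ≡ ℓcs → EntersCS i s ℓ
  byFlag   : Contending ℓ → flag s (opposite i) ≡ 0F → EntersCS i s ℓ
  byVictim : Contending ℓ → victim s ≢ i → EntersCS i s ℓ

cs-before : ∀ {i s l l′} → LocalStep i s l l′ → loc l′ ≡ ℓcs →
            EntersCS i s (loc l)
cs-before (readFlag0 f≡0)   _ = byFlag waitF f≡0
cs-before (readVictim≢ v≢i) _ = byVictim waitV v≢i
cs-before inCS              _ = already refl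

claiming≢ℓflag : ∀ {ℓ} → Claiming ℓ → ℓ ≢ ℓflag
claiming≢ℓflag (contending ()) refl

claiming≢ℓexit : ∀ {ℓ} → Claiming ℓ → ℓ ≢ ℓexit
claiming≢ℓexit (contending ()) refl

contending≢ℓvictim : ∀ {ℓ} → Contending ℓ → ℓ ≢ ℓvictim
contending≢ℓvictim () refl

record Invariant (s : State) : Set where
  field
    claiming⇒flag : ∀ i → Claiming (loc (local s i)) → flag s i ≡ 1F
    cs⇒victim     : ∀ {i j} → i ≢ j → loc (local s i) ≡ ℓcs →
                    Contending (loc (local s j)) → victim s ≡ j
open Invariant

module _ {π : Run} (model : Model π) (t : ℕ) where
  open Model model

  private
    s s′ : State
    s  = state π t
    s′ = state π (suc t)

    a : Thread
    a = act π t

    open Step (step π t)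

  local-unchanged : ∀ {j} → a ≢ j → local s′ j ≡ local s j
  local-unchanged a≢j rewrite ≢⇒≡opposite a≢j = otherLocal

  -- Only the acting thread can have performed `SetVictim`, so its location alone excludes both
  -- disjuncts in the frame condition.
  victim-unchanged : loc (local s a) ≢ ℓvictim → victim s′ ≡ victim s
  victim-unchanged a≢ℓvictim = victimFrame (suc t) (suc t) ≤-refl
    λ { (inj₁ set₀) → ¬setVictim set₀ ; (inj₂ set₁) → ¬setVictim set₁ }
    where
    ¬setVictim : ∀ {i} → ¬ (a ≡ i × loc (local s i) ≡ ℓvictim)
    ¬setVictim (refl , at-ℓvictim) = a≢ℓvictim at-ℓvictim

  claiming-preserved : Invariant s → ∀ i → Claiming (loc (local s′ i)) →
                       flag s′ i ≡ 1F
  claiming-preserved inv i c with a ≟ i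
  ... | no a≢i = trans (ownFlag i (suc t) (suc t) ≤-refl a≢i)
      (claiming⇒flag inv i (subst Claiming (cong loc (local-unchanged a≢i)) c))
  ... | yes refl with claiming-before localStep c
  ...   | inj₁ at-ℓflag = postSetFlag i (suc t) (suc t) ≤-refl (refl , at-ℓflag)
  -- A thread writes its own flag only at `ℓflag` and `ℓexit`, and neither is a claiming location.
  ...   | inj₂ c₀ =
    trans (ownFlagUnwritten (claiming≢ℓflag c₀) (claiming≢ℓexit c₀))
          (claiming⇒flag inv i c₀)

  cs-actor : Invariant s → ∀ {j} → a ≢ j → loc (local s′ a) ≡ ℓcs →
             Contending (loc (local s j)) → victim s′ ≡ j
  cs-actor inv {j} a≢j a-cs j-con with cs-before localStep a-cs
  ... | already a-cs₀ =
    trans (victim-unchanged (contending≢ℓvictim (subst Contending (sym a-cs₀) cs)))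
          (cs⇒victim inv a≢j a-cs₀ j-con)
  -- There are only two threads, so a victim other than `a` is `j`.
  ... | byVictim a-con v≢a =
    trans (victim-unchanged (contending≢ℓvictim a-con))
          (≢-unique (λ a≡v → v≢a (sym a≡v)) a≢j)
  -- Reading `flag[j] = 0` is impossible here: the contending `j` has its flag set.
  ... | byFlag _ f≡0 =
    contradiction (trans (sym f≡0) (subst (λ k → flag s k ≡ 1F) (≢⇒≡opposite a≢j)
                                      (claiming⇒flag inv j (contending j-con))))
                  λ ()

  -- With `i` idle, either `a` has just named itself victim, or it was contending already and the
  -- old invariant carries over.
  cs-other : Invariant s → ∀ {i} → i ≢ a → loc (local s i) ≡ ℓcs →
             Contending (loc (local s′ a)) → victim s′ ≡ a
  cs-other inv i≢a i-cs a-con with contending-before localStep a-con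
  ... | inj₁ at-ℓvictim =
    postSetVictim a (suc t) (suc t) ≤-refl (refl , at-ℓvictim)
  ... | inj₂ a-con₀ = trans (victim-unchanged (contending≢ℓvictim a-con₀))
                            (cs⇒victim inv i≢a i-cs a-con₀)

  cs-preserved : Invariant s → ∀ {i j} → i ≢ j → loc (local s′ i) ≡ ℓcs →
                 Contending (loc (local s′ j)) → victim s′ ≡ j
  cs-preserved inv {i} {j} i≢j i-cs j-con with a ≟ i
  ... | yes refl = cs-actor inv i≢j i-cs
                     (subst Contending (cong loc (local-unchanged i≢j)) j-con)
  -- With two threads, an actor other than `i` must be `j`.
  ... | no a≢i with ≢-unique {i} (λ i≡a → a≢i (sym i≡a)) i≢j
  ...   | refl = cs-other inv i≢j
                   (trans (sym (cong loc (local-unchanged a≢i))) i-cs) j-con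

invariant : ∀ {π} → Model π → ∀ t → Invariant (state π t)
-- Both threads start at `ℓflag`, so both clauses hold vacuously, whatever the initial store.
invariant {π} model zero = record
  { claiming⇒flag = λ i c → contradiction (start π i) (claiming≢ℓflag c)
  ; cs⇒victim     = λ {i} _ i-cs _ → contradiction (trans (sym i-cs) (start π i)) λ ()
  }
invariant model (suc t) = record
  { claiming⇒flag = claiming-preserved model t (invariant model t)
  ; cs⇒victim     = cs-preserved model t (invariant model t)
  }

mainTheorem4 : (π : Run) → Model π → (t : ℕ) →
    (π , t) ⊨ Always (∁ (InCS 0F ∩ InCS 1F))
mainTheorem4 π model _ k _ (cs₀ , cs₁) =
  contradiction (trans (sym (cs⇒victim inv {0F} {1F} (λ ()) cs₀ (subst Contending (sym cs₁) cs)))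
                       (cs⇒victim inv {1F} {0F} (λ ()) cs₁ (subst Contending (sym cs₀) cs)))
                λ ()
  where inv = invariant model k
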